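{- Let $q \ge 3$ and $d \ge 1$ be integers, and let $j$ be an integer with $d - \frac{d-1}{q} \le j \le d$. Then: (i) $K_j(1) \le K_j(i)$ for all integers $i$ with $0 \le i \le d$. (ii) $|K_j(i)| \le |K_j(1)|$ for all integers $i$ with $1 \le i \le d$, unless $(q,d,i,j) = (3,4,3,3)$.
   Context: For integers $q\ge 2$, $d\ge 1$ and $0\le i,j\le d$, $$K_j(i) = \sum_{h=0}^j (-1)^h (q-1)^{j-h} \binom{i}{h} \binom{d-i}{j-h}$$ (the dependence on $q$ and $d$ is suppressed). The numbers $K_j(i)$, $0\le i\le d$, are the eigenvalues of the graph $H(d,q,j)$ whose vertex set is $Q^d$ with $|Q|=q$, two vectors being adjacent when they differ in exactly $j$ coordinates. -}

module Defs where

open import Data.Fin.Base using (toℕ)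
open import Data.Integer using (ℤ; +_; -1ℤ; 1ℤ; _-_; _*_; _^_)
open import Data.Integer.Properties using (+-*-semiring)
open import Data.Nat using (ℕ; _∸_)
open import Data.Nat.Combinatorics using (_C_)
open import Algebra.Properties.Semiring.Sum +-*-semiring using (sum⁺-syntax)

krawtchoukTerm : (q d j i h : ℕ) → ℤ
krawtchoukTerm q d j i h =
  -1ℤ ^ h * (+ q - 1ℤ) ^ (j ∸ h) * + (i C h) * + ((d ∸ i) C (j ∸ h))

-- K q d j i is K_j(i), with the usually suppressed q and d made explicit.
-- It is meant for i ≤ d, where d ∸ i is the true difference (as j ∸ h always
-- is, since h ≤ j in the sum).
K : (q d j i : ℕ) → ℤ
K q d j i = ∑[ h ≤ j ] krawtchoukTerm q d j i (toℕ h)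

{-# OPTIONS --safe #-}

-- Put s = q - 1 and m = d - j, so that the hypothesis reads q m < d. Reversing the
-- generating function (1 - z)^i (1 + s z)^(d-i) shows K_j(i) = (-1)^i A_m(i, d), where
-- A_m(i, d) is the coefficient of z^m in (1 - z)^i (s + z)^(d-i). The claim becomes
-- |A_m(i, d)| ≤ A_m(1, d), with A_m(1, d) ≥ 0.
--
-- From A_m(i+1, d+1) = A_m(i, d) - A_{m-1}(i, d) and
-- A_m(1, d+1) = s A_m(1, d) + A_{m-1}(1, d), induction reduces the claim to the critical
-- case d = q m + 1. There the three-term recurrence
--   s (d-i) A(i+1) = (1 + (s-1) i) A(i) - i A(i-1)
-- gives A(2) = -A(1), and it preserves the bound as long as 2 i < d. For larger i the
-- crude bound |A(i)| ≤ s^(d-i) (d choose m) suffices, since d A(1) = s^(s m) (d choose m),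
-- except for finitely many cases with s = 2. One of these is the excluded (3, 4, 3, 3).
module Submission where

open import Defs
open import Data.Empty using (⊥-elim)
open import Data.Fin.Base using (toℕ)
open import Data.Integer as ℤ using (ℤ; +_; ∣_∣; 0ℤ; 1ℤ; -1ℤ)
open import Data.Integer.Properties as ℤₚ using (pos-*; abs-*)
open import Algebra.Properties.Semiring.Sum ℤₚ.+-*-semiring using (sum⁺-syntax)
open import Data.Integer.Tactic.RingSolver using (solve-∀)
open import Data.Nat using (ℕ; zero; suc; _+_; _*_; _∸_; _^_; _≤_; _<_; z≤n; s≤s; NonZero)
open import Data.Nat.Combinatorics using (_C_; nCk≡nC[n∸k]; nCk+nC[k+1]≡[n+1]C[k+1]; k>n⇒nCk≡0)
import Data.Nat.Properties as ℕₚ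
import Data.Nat.Tactic.RingSolver as ℕ-Ring
open import Data.Product using (_×_; _,_)
open import Data.Rational.Unnormalised as ℚᵘ using (_/_)
open import Data.Sum using (_⊎_; inj₁; inj₂; [_,_]′)
open import Function using (_∘_; id)
open import Relation.Binary.PropositionalEquality using (_≡_; _≢_; refl; sym; trans; cong; cong₂; subst; module ≡-Reasoning)
open import Relation.Nullary using (yes; no)
open import Relation.Nullary.Decidable using (Dec; from-yes; _⊎-dec_; _×-dec_)

-- Coefficients of (1 - z)^a (s + z)^b.

-- Multiplication of a power series by z, on its coefficients.
shift : (ℕ → ℤ) → ℕ → ℤ
shift f zero    = 0ℤ
shift f (suc m) = f m

-- coeff s a b m is the coefficient of z^m in (1 - z)^a (s + z)^b.
coeff : (s a b : ℕ) → ℕ → ℤ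
coeff s zero    zero    zero    = 1ℤ
coeff s zero    zero    (suc m) = 0ℤ
coeff s zero    (suc b) m       = + s ℤ.* coeff s 0 b m ℤ.+ shift (coeff s 0 b) m
coeff s (suc a) b       m       = coeff s a b m ℤ.- shift (coeff s a b) m

k>n⇒coeff≡0 : ∀ s a b {m} → a + b < m → coeff s a b m ≡ 0ℤ
k>n⇒coeff≡0 s zero zero    {suc m} _ = refl
k>n⇒coeff≡0 s zero (suc b) {suc m} (s≤s p) = trans
  (cong₂ (λ x y → + s ℤ.* x ℤ.+ y) (k>n⇒coeff≡0 s 0 b (ℕₚ.m<n⇒m<1+n p)) (k>n⇒coeff≡0 s 0 b p))
  (cong (ℤ._+ 0ℤ) (ℤₚ.*-zeroʳ (+ s)))
k>n⇒coeff≡0 s (suc a) b {suc m} (s≤s p) =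
  cong₂ ℤ._-_ (k>n⇒coeff≡0 s a b (ℕₚ.m<n⇒m<1+n p)) (k>n⇒coeff≡0 s a b p)

nC0≡1 : ∀ n → n C 0 ≡ 1
nC0≡1 zero    = refl
nC0≡1 (suc n) = refl

pascal : ∀ s b m → s ^ (b ∸ m) * (suc b C suc m) ≡
  s * (s ^ (b ∸ suc m) * (b C suc m)) + s ^ (b ∸ m) * (b C m)
pascal s b m with suc m ℕₚ.≤? b
... | yes m<b = begin
  s ^ (b ∸ m) * (suc b C suc m)       ≡⟨ cong (s ^ (b ∸ m) *_) (nCk+nC[k+1]≡[n+1]C[k+1] b m) ⟨
  s ^ (b ∸ m) * (b C m + b C suc m)   ≡⟨ distribute (s ^ (b ∸ m)) (b C m) (b C suc m) ⟩
  s ^ (b ∸ m) * (b C suc m) + s ^ (b ∸ m) * (b C m)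
    ≡⟨ cong (λ k → s ^ k * (b C suc m) + s ^ (b ∸ m) * (b C m)) (ℕₚ.+-∸-assoc 1 m<b) ⟩
  s * s ^ (b ∸ suc m) * (b C suc m) + s ^ (b ∸ m) * (b C m)
    ≡⟨ cong (_+ s ^ (b ∸ m) * (b C m)) (ℕₚ.*-assoc s _ _) ⟩
  s * (s ^ (b ∸ suc m) * (b C suc m)) + s ^ (b ∸ m) * (b C m) ∎
  where
  open ≡-Reasoning
  distribute : ∀ p x y → p * (x + y) ≡ p * y + p * x
  distribute = ℕ-Ring.solve-∀
-- Both exponents truncate to 0 here, so no factor `s` can be split off; the vanishing of
-- `b C suc m` makes up for it.
... | no m≮b = begin
  s ^ (b ∸ m) * (suc b C suc m)       ≡⟨ cong (s ^ (b ∸ m) *_) (nCk+nC[k+1]≡[n+1]C[k+1] b m) ⟨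
  s ^ (b ∸ m) * (b C m + b C suc m)   ≡⟨ cong (λ x → s ^ (b ∸ m) * (b C m + x)) vanish ⟩
  s ^ (b ∸ m) * (b C m + 0)           ≡⟨ rearrange s (s ^ (b ∸ m)) (s ^ (b ∸ suc m)) (b C m) ⟩
  s * (s ^ (b ∸ suc m) * 0) + s ^ (b ∸ m) * (b C m)
    ≡⟨ cong (λ x → s * (s ^ (b ∸ suc m) * x) + s ^ (b ∸ m) * (b C m)) vanish ⟨
  s * (s ^ (b ∸ suc m) * (b C suc m)) + s ^ (b ∸ m) * (b C m) ∎
  where
  open ≡-Reasoning
  vanish : b C suc m ≡ 0
  vanish = k>n⇒nCk≡0 (ℕₚ.≰⇒> m≮b)
  rearrange : ∀ s p r x → p * (x + 0) ≡ s * (r * 0) + p * x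
  rearrange = ℕ-Ring.solve-∀

coeff₀-formula : ∀ s b m → coeff s 0 b m ≡ + (s ^ (b ∸ m) * (b C m))
coeff₀-formula s zero    zero    = refl
coeff₀-formula s zero    (suc m) = refl
coeff₀-formula s (suc b) zero    = begin
  + s ℤ.* coeff s 0 b 0 ℤ.+ 0ℤ    ≡⟨ ℤₚ.+-identityʳ _ ⟩
  + s ℤ.* coeff s 0 b 0           ≡⟨ cong (+ s ℤ.*_) (coeff₀-formula s b 0) ⟩
  + s ℤ.* + (s ^ b * (b C 0))     ≡⟨ pos-* s _ ⟨
  + (s * (s ^ b * (b C 0)))       ≡⟨ cong +_ (ℕₚ.*-assoc s (s ^ b) _) ⟨
  + (s * s ^ b * (b C 0))         ≡⟨ cong (λ x → + (s * s ^ b * x)) (trans (nC0≡1 b) (sym (nC0≡1 (suc b)))) ⟩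
  + (s * s ^ b * (suc b C 0))     ∎
  where open ≡-Reasoning
coeff₀-formula s (suc b) (suc m) = begin
  + s ℤ.* coeff s 0 b (suc m) ℤ.+ coeff s 0 b m
    ≡⟨ cong₂ (λ x y → + s ℤ.* x ℤ.+ y) (coeff₀-formula s b (suc m)) (coeff₀-formula s b m) ⟩
  + s ℤ.* + (s ^ (b ∸ suc m) * (b C suc m)) ℤ.+ + (s ^ (b ∸ m) * (b C m))
    ≡⟨ cong (ℤ._+ + (s ^ (b ∸ m) * (b C m))) (pos-* s _) ⟨
  + (s * (s ^ (b ∸ suc m) * (b C suc m)) + s ^ (b ∸ m) * (b C m))
    ≡⟨ cong +_ (pascal s b m) ⟨
  + (s ^ (b ∸ m) * (suc b C suc m)) ∎
  where open ≡-Reasoning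

-- `coeff` peels off the factors 1 - z first, so for a > 0 this expresses that multiplication by 1 -
-- z commutes with multiplication by s + z.
coeff-sucʳ : ∀ s a b m →
  coeff s a (suc b) m ≡ + s ℤ.* coeff s a b m ℤ.+ shift (coeff s a b) m
coeff-sucʳ s zero b m = refl
coeff-sucʳ s (suc a) b zero
  rewrite coeff-sucʳ s a b zero = identity (+ s) (coeff s a b 0)
  where
  identity : ∀ s x → (s ℤ.* x ℤ.+ 0ℤ) ℤ.- 0ℤ ≡ s ℤ.* (x ℤ.- 0ℤ) ℤ.+ 0ℤ
  identity = solve-∀
coeff-sucʳ s (suc a) b (suc m)
  rewrite coeff-sucʳ s a b (suc m) | coeff-sucʳ s a b m =
  identity (+ s) (coeff s a b (suc m)) (coeff s a b m) (shift (coeff s a b) m)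
  where
  identity : ∀ s x y z → (s ℤ.* x ℤ.+ y) ℤ.- (s ℤ.* y ℤ.+ z) ≡ s ℤ.* (x ℤ.- y) ℤ.+ (y ℤ.- z)
  identity = solve-∀

-- Differential equation and recurrences.

-- This is (s + z) G′ = b G for G = (s + z)^b, read at z^m. Induction on `b` avoids the truncated
-- exponents of the closed form: the difference of the two sides for `suc b` is a combination of
-- such differences for `b`.
coeff₀-ratio : ∀ s b m →
  + s ℤ.* (1ℤ ℤ.+ + m) ℤ.* coeff s 0 b (suc m) ≡ (+ b ℤ.- + m) ℤ.* coeff s 0 b m
coeff₀-ratio s zero zero    = ℤₚ.*-zeroʳ (+ s ℤ.* 1ℤ)
coeff₀-ratio s zero (suc m) = trans (ℤₚ.*-zeroʳ (+ s ℤ.* (1ℤ ℤ.+ + suc m))) (sym (ℤₚ.*-zeroʳ (0ℤ ℤ.- + suc m)))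
coeff₀-ratio s (suc b) zero =
  ℤₚ.i-j≡0⇒i≡j _ _ (trans (identity (+ s) (+ b) (coeff s 0 b 1) (coeff s 0 b 0))
    (trans (cong (+ s ℤ.*_) (ℤₚ.i≡j⇒i-j≡0 (coeff₀-ratio s b 0))) (ℤₚ.*-zeroʳ (+ s))))
  where
  identity : ∀ s b x y →
    s ℤ.* (1ℤ ℤ.+ 0ℤ) ℤ.* (s ℤ.* x ℤ.+ y) ℤ.- ((1ℤ ℤ.+ b) ℤ.- 0ℤ) ℤ.* (s ℤ.* y ℤ.+ 0ℤ) ≡
    s ℤ.* (s ℤ.* (1ℤ ℤ.+ 0ℤ) ℤ.* x ℤ.- (b ℤ.- 0ℤ) ℤ.* y)
  identity = solve-∀
coeff₀-ratio s (suc b) (suc m) =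
  ℤₚ.i-j≡0⇒i≡j _ _ (trans
    (identity (+ s) (+ b) (+ m) (coeff s 0 b (suc (suc m))) (coeff s 0 b (suc m)) (coeff s 0 b m))
    (trans (cong₂ (λ u v → + s ℤ.* u ℤ.+ v) (ℤₚ.i≡j⇒i-j≡0 (coeff₀-ratio s b (suc m)))
        (ℤₚ.i≡j⇒i-j≡0 (coeff₀-ratio s b m)))
      (cong (ℤ._+ 0ℤ) (ℤₚ.*-zeroʳ (+ s)))))
  where
  identity : ∀ s b m x y z →
    s ℤ.* (1ℤ ℤ.+ (1ℤ ℤ.+ m)) ℤ.* (s ℤ.* x ℤ.+ y) ℤ.-
      ((1ℤ ℤ.+ b) ℤ.- (1ℤ ℤ.+ m)) ℤ.* (s ℤ.* y ℤ.+ z) ≡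
    s ℤ.* (s ℤ.* (1ℤ ℤ.+ (1ℤ ℤ.+ m)) ℤ.* x ℤ.- (b ℤ.- (1ℤ ℤ.+ m)) ℤ.* y) ℤ.+
      (s ℤ.* (1ℤ ℤ.+ m) ℤ.* y ℤ.- (b ℤ.- m) ℤ.* z)
  identity = solve-∀

-- The coefficient of z^m in the differential equation
-- (1 - z)(s + z) G′ = (b (1 - z) - a (s + z)) G  for  G = (1 - z)^a (s + z)^b.
coeff-ode : ∀ s a b m →
  + s ℤ.* (1ℤ ℤ.+ + m) ℤ.* coeff s a b (suc m) ℤ.+ (1ℤ ℤ.- + s) ℤ.* + m ℤ.* coeff s a b m
    ℤ.- (+ m ℤ.- 1ℤ) ℤ.* shift (coeff s a b) m
  ≡ (+ b ℤ.- + a ℤ.* + s) ℤ.* coeff s a b m ℤ.- (+ a ℤ.+ + b) ℤ.* shift (coeff s a b) m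
coeff-ode s zero b zero = ℤₚ.i-j≡0⇒i≡j _ _ (trans
  (identity (+ s) (+ b) (coeff s 0 b 1) (coeff s 0 b 0))
  (ℤₚ.i≡j⇒i-j≡0 (coeff₀-ratio s b 0)))
  where
  identity : ∀ s b x y →
    (s ℤ.* (1ℤ ℤ.+ 0ℤ) ℤ.* x ℤ.+ (1ℤ ℤ.- s) ℤ.* 0ℤ ℤ.* y ℤ.- (0ℤ ℤ.- 1ℤ) ℤ.* 0ℤ) ℤ.-
      ((b ℤ.- 0ℤ ℤ.* s) ℤ.* y ℤ.- (0ℤ ℤ.+ b) ℤ.* 0ℤ) ≡
    s ℤ.* (1ℤ ℤ.+ 0ℤ) ℤ.* x ℤ.- (b ℤ.- 0ℤ) ℤ.* y
  identity = solve-∀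
coeff-ode s zero b (suc m) = ℤₚ.i-j≡0⇒i≡j _ _ (trans
  (identity (+ s) (+ b) (+ m) (coeff s 0 b (suc (suc m))) (coeff s 0 b (suc m)) (coeff s 0 b m))
  (cong₂ ℤ._-_ (ℤₚ.i≡j⇒i-j≡0 (coeff₀-ratio s b (suc m))) (ℤₚ.i≡j⇒i-j≡0 (coeff₀-ratio s b m))))
  where
  identity : ∀ s b m x y z →
    (s ℤ.* (1ℤ ℤ.+ (1ℤ ℤ.+ m)) ℤ.* x ℤ.+ (1ℤ ℤ.- s) ℤ.* (1ℤ ℤ.+ m) ℤ.* y
        ℤ.- ((1ℤ ℤ.+ m) ℤ.- 1ℤ) ℤ.* z) ℤ.-
      ((b ℤ.- 0ℤ ℤ.* s) ℤ.* y ℤ.- (0ℤ ℤ.+ b) ℤ.* z) ≡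
    (s ℤ.* (1ℤ ℤ.+ (1ℤ ℤ.+ m)) ℤ.* x ℤ.- (b ℤ.- (1ℤ ℤ.+ m)) ℤ.* y) ℤ.-
      (s ℤ.* (1ℤ ℤ.+ m) ℤ.* y ℤ.- (b ℤ.- m) ℤ.* z)
  identity = solve-∀
coeff-ode s (suc a) b zero = ℤₚ.i-j≡0⇒i≡j _ _ (trans
  (identity (+ s) (+ a) (+ b) (coeff s a b 1) (coeff s a b 0))
  (ℤₚ.i≡j⇒i-j≡0 (coeff-ode s a b 0)))
  where
  identity : ∀ s a b x y →
    (s ℤ.* (1ℤ ℤ.+ 0ℤ) ℤ.* (x ℤ.- y) ℤ.+ (1ℤ ℤ.- s) ℤ.* 0ℤ ℤ.* (y ℤ.- 0ℤ)
        ℤ.- (0ℤ ℤ.- 1ℤ) ℤ.* 0ℤ) ℤ.-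
      ((b ℤ.- (1ℤ ℤ.+ a) ℤ.* s) ℤ.* (y ℤ.- 0ℤ) ℤ.- ((1ℤ ℤ.+ a) ℤ.+ b) ℤ.* 0ℤ) ≡
    (s ℤ.* (1ℤ ℤ.+ 0ℤ) ℤ.* x ℤ.+ (1ℤ ℤ.- s) ℤ.* 0ℤ ℤ.* y ℤ.- (0ℤ ℤ.- 1ℤ) ℤ.* 0ℤ) ℤ.-
      ((b ℤ.- a ℤ.* s) ℤ.* y ℤ.- (a ℤ.+ b) ℤ.* 0ℤ)
  identity = solve-∀
coeff-ode s (suc a) b (suc m) = ℤₚ.i-j≡0⇒i≡j _ _ (trans
  (identity (+ s) (+ a) (+ b) (+ m) (coeff s a b (suc (suc m))) (coeff s a b (suc m))
    (coeff s a b m) (shift (coeff s a b) m))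
  (cong₂ ℤ._-_ (ℤₚ.i≡j⇒i-j≡0 (coeff-ode s a b (suc m))) (ℤₚ.i≡j⇒i-j≡0 (coeff-ode s a b m))))
  where
  identity : ∀ s a b m x y z w →
    (s ℤ.* (1ℤ ℤ.+ (1ℤ ℤ.+ m)) ℤ.* (x ℤ.- y) ℤ.+ (1ℤ ℤ.- s) ℤ.* (1ℤ ℤ.+ m) ℤ.* (y ℤ.- z)
        ℤ.- ((1ℤ ℤ.+ m) ℤ.- 1ℤ) ℤ.* (z ℤ.- w)) ℤ.-
      ((b ℤ.- (1ℤ ℤ.+ a) ℤ.* s) ℤ.* (y ℤ.- z) ℤ.- ((1ℤ ℤ.+ a) ℤ.+ b) ℤ.* (z ℤ.- w)) ≡
    ((s ℤ.* (1ℤ ℤ.+ (1ℤ ℤ.+ m)) ℤ.* x ℤ.+ (1ℤ ℤ.- s) ℤ.* (1ℤ ℤ.+ m) ℤ.* y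
        ℤ.- ((1ℤ ℤ.+ m) ℤ.- 1ℤ) ℤ.* z) ℤ.-
      ((b ℤ.- a ℤ.* s) ℤ.* y ℤ.- (a ℤ.+ b) ℤ.* z)) ℤ.-
    ((s ℤ.* (1ℤ ℤ.+ m) ℤ.* y ℤ.+ (1ℤ ℤ.- s) ℤ.* m ℤ.* z ℤ.- (m ℤ.- 1ℤ) ℤ.* w) ℤ.-
      ((b ℤ.- a ℤ.* s) ℤ.* z ℤ.- (a ℤ.+ b) ℤ.* w))
  identity = solve-∀

-- The classical recurrence in i, for i = a + 1 and d = a + b + 2.
three-term : ∀ s a b m →
  + s ℤ.* (1ℤ ℤ.+ + b) ℤ.* coeff s (2 + a) b (suc m) ℤ.+ (1ℤ ℤ.+ + a) ℤ.* coeff s a (2 + b) (suc m)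
  ≡ (+ (2 + a + b) ℤ.- (1ℤ ℤ.+ + s) ℤ.* (1ℤ ℤ.+ + m) ℤ.+ (+ s ℤ.- 1ℤ) ℤ.* (1ℤ ℤ.+ + a))
    ℤ.* coeff s (1 + a) (1 + b) (suc m)
-- Once everything is written through the coefficients of `coeff s a b` at m + 1, m and m - 1, the
-- difference of the two sides is 1 + s times that of `coeff-ode`.
three-term s a b m
  rewrite coeff-sucʳ s a (suc b) (suc m) | coeff-sucʳ s a b (suc m) | coeff-sucʳ s a b m = ℤₚ.i-j≡0⇒i≡j _ _ (trans
  (identity (+ s) (+ a) (+ b) (+ m) (coeff s a b (suc m)) (coeff s a b m) (shift (coeff s a b) m))
  (trans (cong ((1ℤ ℤ.+ + s) ℤ.*_) (ℤₚ.i≡j⇒i-j≡0 (coeff-ode s a b m))) (ℤₚ.*-zeroʳ (1ℤ ℤ.+ + s))))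
  where
  identity : ∀ s a b m x y z →
    (s ℤ.* (1ℤ ℤ.+ b) ℤ.* ((x ℤ.- y) ℤ.- (y ℤ.- z)) ℤ.+
      (1ℤ ℤ.+ a) ℤ.* (s ℤ.* (s ℤ.* x ℤ.+ y) ℤ.+ (s ℤ.* y ℤ.+ z))) ℤ.-
    ((1ℤ ℤ.+ (1ℤ ℤ.+ (a ℤ.+ b))) ℤ.- (1ℤ ℤ.+ s) ℤ.* (1ℤ ℤ.+ m) ℤ.+ (s ℤ.- 1ℤ) ℤ.* (1ℤ ℤ.+ a))
      ℤ.* ((s ℤ.* x ℤ.+ y) ℤ.- (s ℤ.* y ℤ.+ z)) ≡
    (1ℤ ℤ.+ s) ℤ.* ((s ℤ.* (1ℤ ℤ.+ m) ℤ.* x ℤ.+ (1ℤ ℤ.- s) ℤ.* m ℤ.* y ℤ.- (m ℤ.- 1ℤ) ℤ.* z) ℤ.-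
      ((b ℤ.- a ℤ.* s) ℤ.* y ℤ.- (a ℤ.+ b) ℤ.* z))
  identity = solve-∀

-- With d = n + 1 and q = s + 1 the factor on the right is d - q m. It settles the sign of A_m(1, d)
-- when q m ≤ d, and it equals 1 in the critical case.
coeff₁-coeff₀ : ∀ s n m →
  + s ℤ.* (1ℤ ℤ.+ + n) ℤ.* coeff s 1 n m ≡
  ((1ℤ ℤ.+ + n) ℤ.- (1ℤ ℤ.+ + s) ℤ.* + m) ℤ.* coeff s 0 (suc n) m
coeff₁-coeff₀ s n zero = identity (+ s) (+ n) (coeff s 0 n 0)
  where
  identity : ∀ s n x → s ℤ.* (1ℤ ℤ.+ n) ℤ.* (x ℤ.- 0ℤ) ≡
    ((1ℤ ℤ.+ n) ℤ.- (1ℤ ℤ.+ s) ℤ.* 0ℤ) ℤ.* (s ℤ.* x ℤ.+ 0ℤ)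
  identity = solve-∀
coeff₁-coeff₀ s n (suc m) = ℤₚ.i-j≡0⇒i≡j _ _ (trans
  (identity (+ s) (+ n) (+ m) (coeff s 0 n (suc m)) (coeff s 0 n m))
  (trans (cong ((1ℤ ℤ.+ + s) ℤ.*_) (ℤₚ.i≡j⇒i-j≡0 (coeff₀-ratio s n m))) (ℤₚ.*-zeroʳ (1ℤ ℤ.+ + s))))
  where
  identity : ∀ s n m x y →
    s ℤ.* (1ℤ ℤ.+ n) ℤ.* (x ℤ.- y) ℤ.-
      ((1ℤ ℤ.+ n) ℤ.- (1ℤ ℤ.+ s) ℤ.* (1ℤ ℤ.+ m)) ℤ.* (s ℤ.* x ℤ.+ y) ≡
    (1ℤ ℤ.+ s) ℤ.* (s ℤ.* (1ℤ ℤ.+ m) ℤ.* x ℤ.- (n ℤ.- m) ℤ.* y)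
  identity = solve-∀

-- Crude bound, and the coefficients at i = 1.

-- By the triangle inequality each factor 1 - z counts as 1 + z, which gives Pascal's rule; every
-- power of `s` is replaced by s^b, using s = `suc t` ≥ 1.
∣coeff∣-crude : ∀ t a b m → ∣ coeff (suc t) a b m ∣ ≤ suc t ^ b * ((a + b) C m)
∣coeff∣-crude t zero b m rewrite coeff₀-formula (suc t) b m =
  ℕₚ.*-monoˡ-≤ (b C m) (ℕₚ.^-monoʳ-≤ (suc t) (ℕₚ.m∸n≤m b m))
∣coeff∣-crude t (suc a) b zero = begin
  ∣ coeff (suc t) a b 0 ℤ.- 0ℤ ∣   ≡⟨ cong ∣_∣ (ℤₚ.+-identityʳ (coeff (suc t) a b 0)) ⟩
  ∣ coeff (suc t) a b 0 ∣          ≤⟨ ∣coeff∣-crude t a b 0 ⟩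
  suc t ^ b * ((a + b) C 0)        ≡⟨ cong (suc t ^ b *_) (trans (nC0≡1 (a + b)) (sym (nC0≡1 (suc a + b)))) ⟩
  suc t ^ b * ((suc a + b) C 0)    ∎
  where open ℕₚ.≤-Reasoning
∣coeff∣-crude t (suc a) b (suc m) = begin
  ∣ coeff (suc t) a b (suc m) ℤ.- coeff (suc t) a b m ∣
    ≤⟨ ℤₚ.∣i-j∣≤∣i∣+∣j∣ (coeff (suc t) a b (suc m)) (coeff (suc t) a b m) ⟩
  ∣ coeff (suc t) a b (suc m) ∣ + ∣ coeff (suc t) a b m ∣
    ≤⟨ ℕₚ.+-mono-≤ (∣coeff∣-crude t a b (suc m)) (∣coeff∣-crude t a b m) ⟩
  suc t ^ b * ((a + b) C suc m) + suc t ^ b * ((a + b) C m)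
    ≡⟨ ℕₚ.*-distribˡ-+ (suc t ^ b) ((a + b) C suc m) ((a + b) C m) ⟨
  suc t ^ b * ((a + b) C suc m + (a + b) C m)
    ≡⟨ cong (suc t ^ b *_) (ℕₚ.+-comm ((a + b) C suc m) ((a + b) C m)) ⟩
  suc t ^ b * ((a + b) C m + (a + b) C suc m)
    ≡⟨ cong (suc t ^ b *_) (nCk+nC[k+1]≡[n+1]C[k+1] (a + b) m) ⟩
  suc t ^ b * (suc (a + b) C suc m) ∎
  where open ℕₚ.≤-Reasoning

coeff₀-nonNeg : ∀ s b m → 0ℤ ℤ.≤ coeff s 0 b m
coeff₀-nonNeg s b m rewrite coeff₀-formula s b m = ℤ.+≤+ z≤n

cast-difference : ∀ s m k {d} → suc s * m + k ≡ d → + d ℤ.- (1ℤ ℤ.+ + s) ℤ.* + m ≡ + k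
cast-difference s m k refl = trans (cong (λ x → (x ℤ.+ + k) ℤ.- + suc s ℤ.* + m) (pos-* (suc s) m))
  (cancel (+ suc s ℤ.* + m) (+ k))
  where
  cancel : ∀ x y → (x ℤ.+ y) ℤ.- x ≡ y
  cancel = solve-∀

coeff₁-nonNeg : ∀ t n m → suc (suc t) * m ≤ suc n → 0ℤ ℤ.≤ coeff (suc t) 1 n m
coeff₁-nonNeg t n m p = ℤₚ.*-cancelˡ-≤-pos 0ℤ (coeff s 1 n m) (+ s ℤ.* + suc n) (begin
  + s ℤ.* + suc n ℤ.* 0ℤ                ≡⟨ ℤₚ.*-zeroʳ (+ s ℤ.* + suc n) ⟩
  0ℤ                                    ≡⟨ ℤₚ.*-zeroʳ (+ k) ⟨
  + k ℤ.* 0ℤ                            ≤⟨ ℤₚ.*-monoˡ-≤-nonNeg (+ k) (coeff₀-nonNeg s (suc n) m) ⟩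
  + k ℤ.* coeff s 0 (suc n) m
    ≡⟨ cong (ℤ._* coeff s 0 (suc n) m) (cast-difference s m k (ℕₚ.m+[n∸m]≡n p)) ⟨
  (+ suc n ℤ.- + suc s ℤ.* + m) ℤ.* coeff s 0 (suc n) m ≡⟨ coeff₁-coeff₀ s n m ⟨
  + s ℤ.* + suc n ℤ.* coeff s 1 n m     ∎)
  where
  open ℤₚ.≤-Reasoning
  s k : ℕ
  s = suc t
  k = suc n ∸ suc s * m

-- Both terms of `coeff-sucʳ` are non-negative in this range, so the absolute values add without
-- loss. The induction in `bound` compares against this sum.
∣coeff₁∣-suc : ∀ t n m → suc (suc t) * m ≤ suc n →
  ∣ coeff (suc t) 1 (suc n) m ∣ ≡ suc t * ∣ coeff (suc t) 1 n m ∣ + ∣ shift (coeff (suc t) 1 n) m ∣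
∣coeff₁∣-suc t n m p = begin
  ∣ coeff s 1 (suc n) m ∣                               ≡⟨ cong ∣_∣ (coeff-sucʳ s 1 n m) ⟩
  ∣ + s ℤ.* coeff s 1 n m ℤ.+ shift (coeff s 1 n) m ∣
    ≡⟨ cong₂ (λ x y → ∣ + s ℤ.* x ℤ.+ y ∣) (ℤₚ.0≤i⇒+∣i∣≡i (coeff₁-nonNeg t n m p)) (ℤₚ.0≤i⇒+∣i∣≡i (nonNeg m p)) ⟨
  ∣ + s ℤ.* + x ℤ.+ + y ∣                              ≡⟨ cong (λ z → ∣ z ℤ.+ + y ∣) (pos-* s x) ⟨
  s * x + y                                             ∎
  where
  open ≡-Reasoning
  s x y : ℕ
  s = suc t
  x = ∣ coeff s 1 n m ∣
  y = ∣ shift (coeff s 1 n) m ∣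
  nonNeg : ∀ m → suc s * m ≤ suc n → 0ℤ ℤ.≤ shift (coeff s 1 n) m
  nonNeg zero    _ = ℤ.+≤+ z≤n
  nonNeg (suc m) p = coeff₁-nonNeg t n m (ℕₚ.≤-trans (ℕₚ.*-monoʳ-≤ (suc s) (ℕₚ.n≤1+n m)) p)

-- The critical case d = q (d - j) + 1.

-- Up to critical-bound, d = n + 1 with n = (s + 1)(m + 1): the least d allowed for
-- the index m + 1.

coeff₁-critical : ∀ t m n → suc (suc t) * suc m ≡ n →
  + suc t ℤ.* + suc n ℤ.* coeff (suc t) 1 n (suc m) ≡ coeff (suc t) 0 (suc n) (suc m)
coeff₁-critical t m n e = trans (coeff₁-coeff₀ (suc t) n (suc m)) (trans
  (cong (ℤ._* coeff (suc t) 0 (suc n) (suc m))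
    (cast-difference (suc t) (suc m) 1 (trans (ℕₚ.+-comm _ 1) (cong suc e))))
  (ℤₚ.*-identityˡ (coeff (suc t) 0 (suc n) (suc m))))

-- The exact value against which the crude bound is measured. The closed form of `coeff₀-formula`
-- has exponent n + 1 - M = s M + 1 for M = m + 1, and one factor `s` cancels.
∣coeff₁∣-critical : ∀ t m n → suc (suc t) * suc m ≡ n →
  suc n * ∣ coeff (suc t) 1 n (suc m) ∣ ≡ suc t ^ (suc t * suc m) * (suc n C suc m)
∣coeff₁∣-critical t m n e = ℕₚ.*-cancelˡ-≡ _ _ s (begin
  s * (suc n * ∣ coeff s 1 n M ∣)               ≡⟨ ℕₚ.*-assoc s (suc n) _ ⟨
  s * suc n * ∣ coeff s 1 n M ∣                 ≡⟨ cong (_* ∣ coeff s 1 n M ∣) (abs-* (+ s) (+ suc n)) ⟨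
  ∣ + s ℤ.* + suc n ∣ * ∣ coeff s 1 n M ∣       ≡⟨ abs-* (+ s ℤ.* + suc n) (coeff s 1 n M) ⟨
  ∣ + s ℤ.* + suc n ℤ.* coeff s 1 n M ∣         ≡⟨ cong ∣_∣ (coeff₁-critical t m n e) ⟩
  ∣ coeff s 0 (suc n) M ∣                       ≡⟨ cong ∣_∣ (coeff₀-formula s (suc n) M) ⟩
  s ^ (suc n ∸ M) * (suc n C M)                 ≡⟨ cong (λ k → s ^ k * (suc n C M)) n+1∸M ⟩
  s * s ^ (s * M) * (suc n C M)                 ≡⟨ ℕₚ.*-assoc s (s ^ (s * M)) (suc n C M) ⟩
  s * (s ^ (s * M) * (suc n C M))               ∎)
  where
  open ≡-Reasoning
  s M : ℕ
  s = suc t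
  M = suc m
  n+1∸M : suc n ∸ M ≡ suc (s * M)
  n+1∸M = trans (cong (λ x → suc x ∸ M) (sym e))
    (trans (cong (_∸ M) (sym (ℕₚ.+-suc M (s * M)))) (ℕₚ.m+n∸m≡n M (suc (s * M))))

-- Here d = a + b + 2 = q (m + 1) + 1, so the part d - q (m + 1) of the middle factor of
-- `three-term` is 1.
three-term-critical : ∀ t a b m → suc (suc t) * suc m ≡ suc (a + b) →
  + suc t ℤ.* + suc b ℤ.* coeff (suc t) (2 + a) b (suc m) ≡
  + suc (t * suc a) ℤ.* coeff (suc t) (1 + a) (1 + b) (suc m) ℤ.- + suc a ℤ.* coeff (suc t) a (2 + b) (suc m)
three-term-critical t a b m e = begin
  x                           ≡⟨ isolate x y ⟩
  (x ℤ.+ y) ℤ.- y             ≡⟨ cong (ℤ._- y) (three-term s a b m) ⟩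
  (+ (2 + a + b) ℤ.- + suc s ℤ.* + suc m ℤ.+ + t ℤ.* + suc a) ℤ.* z ℤ.- y
    ≡⟨ cong₂ (λ k l → (k ℤ.+ l) ℤ.* z ℤ.- y)
         (cast-difference s (suc m) 1 (trans (ℕₚ.+-comm _ 1) (cong suc e))) (sym (pos-* t (suc a))) ⟩
  + suc (t * suc a) ℤ.* z ℤ.- y ∎
  where
  open ≡-Reasoning
  s : ℕ
  s = suc t
  x y z : ℤ
  x = + s ℤ.* + suc b ℤ.* coeff s (2 + a) b (suc m)
  y = + suc a ℤ.* coeff s a (2 + b) (suc m)
  z = coeff s (1 + a) (1 + b) (suc m)
  isolate : ∀ x y → x ≡ (x ℤ.+ y) ℤ.- y
  isolate = solve-∀

-- The recurrence at i = 1 together with A(0) = s d A(1): s (d-1) A(2) = s A(1) - s d A(1).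
coeff₂-critical : ∀ t b m → suc (suc t) * suc m ≡ suc b →
  coeff (suc t) 2 b (suc m) ≡ ℤ.- coeff (suc t) 1 (suc b) (suc m)
coeff₂-critical t b m e = ℤₚ.*-cancelˡ-≡ (+ s ℤ.* + suc b) x (ℤ.- y) (begin
  + s ℤ.* + suc b ℤ.* x                                 ≡⟨ three-term-critical t 0 b m e ⟩
  + suc (t * 1) ℤ.* y ℤ.- + 1 ℤ.* coeff s 0 (2 + b) (suc m)
    ≡⟨ cong₂ (λ k l → + suc k ℤ.* y ℤ.- + 1 ℤ.* l) (ℕₚ.*-identityʳ t) (sym (coeff₁-critical t m (suc b) e)) ⟩
  + s ℤ.* y ℤ.- 1ℤ ℤ.* (+ s ℤ.* + suc (suc b) ℤ.* y)    ≡⟨ collect (+ s) (+ suc b) y ⟩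
  + s ℤ.* + suc b ℤ.* (ℤ.- y)                           ∎)
  where
  open ≡-Reasoning
  s : ℕ
  s = suc t
  x y : ℤ
  x = coeff s 2 b (suc m)
  y = coeff s 1 (suc b) (suc m)
  collect : ∀ s b y → s ℤ.* y ℤ.- 1ℤ ℤ.* (s ℤ.* (1ℤ ℤ.+ b) ℤ.* y) ≡ s ℤ.* b ℤ.* (ℤ.- y)
  collect = solve-∀

∣three-term∣-critical : ∀ t a b m → suc (suc t) * suc m ≡ suc (a + b) →
  suc t * suc b * ∣ coeff (suc t) (2 + a) b (suc m) ∣ ≤
  suc (t * suc a) * ∣ coeff (suc t) (1 + a) (1 + b) (suc m) ∣ + suc a * ∣ coeff (suc t) a (2 + b) (suc m) ∣
∣three-term∣-critical t a b m e = begin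
  s * suc b * ∣ x ∣                                     ≡⟨ cong (_* ∣ x ∣) (abs-* (+ s) (+ suc b)) ⟨
  ∣ + s ℤ.* + suc b ∣ * ∣ x ∣                           ≡⟨ abs-* (+ s ℤ.* + suc b) x ⟨
  ∣ + s ℤ.* + suc b ℤ.* x ∣                             ≡⟨ cong ∣_∣ (three-term-critical t a b m e) ⟩
  ∣ + suc (t * suc a) ℤ.* y ℤ.- + suc a ℤ.* z ∣         ≤⟨ ℤₚ.∣i-j∣≤∣i∣+∣j∣ (+ suc (t * suc a) ℤ.* y) (+ suc a ℤ.* z) ⟩
  ∣ + suc (t * suc a) ℤ.* y ∣ + ∣ + suc a ℤ.* z ∣       ≡⟨ cong₂ _+_ (abs-* (+ suc (t * suc a)) y) (abs-* (+ suc a) z) ⟩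
  suc (t * suc a) * ∣ y ∣ + suc a * ∣ z ∣               ∎
  where
  open ℕₚ.≤-Reasoning
  s : ℕ
  s = suc t
  x y z : ℤ
  x = coeff s (2 + a) b (suc m)
  y = coeff s (1 + a) (1 + b) (suc m)
  z = coeff s a (2 + b) (suc m)

-- Induction by the recurrence, started at i = 1 and i = 2 because A(0) = s d A(1) is too large to
-- serve as a base. The weights on the right add up to 1 + s (2 + a), which is at most s (b + 1)
-- since 1 ≤ s and 2 + a ≤ b.
first-half-bound : ∀ t m n → suc (suc t) * suc m ≡ n → ∀ a b → a + b ≡ n → a ≤ b →
  ∣ coeff (suc t) (suc a) b (suc m) ∣ ≤ ∣ coeff (suc t) 1 n (suc m) ∣
first-half-bound t m n e zero          b refl _ = ℕₚ.≤-refl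
first-half-bound t m n e (suc zero)    b refl _ =
  ℕₚ.≤-reflexive (trans (cong ∣_∣ (coeff₂-critical t b m e)) (ℤₚ.∣-i∣≡∣i∣ (coeff (suc t) 1 (suc b) (suc m))))
first-half-bound t m n e (suc (suc a)) b a+b≡n a≤b = ℕₚ.*-cancelˡ-≤ (s * suc b) (begin
  s * suc b * ∣ coeff s (3 + a) b (suc m) ∣     ≤⟨ ∣three-term∣-critical t (suc a) b m (trans e (sym a+b≡n)) ⟩
  suc (t * (2 + a)) * ∣ coeff s (2 + a) (1 + b) (suc m) ∣ + (2 + a) * ∣ coeff s (1 + a) (2 + b) (suc m) ∣
    ≤⟨ ℕₚ.+-mono-≤
         (ℕₚ.*-monoʳ-≤ (suc (t * (2 + a))) (first-half-bound t m n e (suc a) (suc b)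
           (trans (cong suc (ℕₚ.+-suc a b)) a+b≡n) (s≤s (ℕₚ.<⇒≤ (ℕₚ.<⇒≤ a≤b)))))
         (ℕₚ.*-monoʳ-≤ (2 + a) (first-half-bound t m n e a (2 + b)
           (trans (trans (ℕₚ.+-suc a (suc b)) (cong suc (ℕₚ.+-suc a b))) a+b≡n)
           (ℕₚ.m≤n⇒m≤1+n (ℕₚ.m≤n⇒m≤1+n (ℕₚ.<⇒≤ (ℕₚ.<⇒≤ a≤b)))))) ⟩
  suc (t * (2 + a)) * c₁ + (2 + a) * c₁         ≡⟨ collect t a c₁ ⟩
  (1 + s * (2 + a)) * c₁                        ≤⟨ ℕₚ.*-monoˡ-≤ c₁ (ℕₚ.+-mono-≤ (s≤s (z≤n {t})) (ℕₚ.*-monoʳ-≤ s a≤b)) ⟩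
  (s + s * b) * c₁                              ≡⟨ cong (_* c₁) (ℕₚ.*-suc s b) ⟨
  s * suc b * c₁                                ∎)
  where
  open ℕₚ.≤-Reasoning
  s c₁ : ℕ
  s  = suc t
  c₁ = ∣ coeff s 1 n (suc m) ∣
  collect : ∀ t a c → suc (t * (2 + a)) * c + (2 + a) * c ≡ (1 + suc t * (2 + a)) * c
  collect = ℕ-Ring.solve-∀

-- The choice e = a - M with M = m + 1 makes e + b = s M, so after multiplication by d = n + 1 the
-- crude bound stays below `∣coeff₁∣-critical` as soon as d ≤ s^e.
large-index-bound : ∀ t m n → suc (suc t) * suc m ≡ n → ∀ a b → a + b ≡ n →
  ∀ e → a ≡ suc m + e → suc n ≤ suc t ^ e →
  ∣ coeff (suc t) (suc a) b (suc m) ∣ ≤ ∣ coeff (suc t) 1 n (suc m) ∣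
large-index-bound t m n n≡ a b a+b≡n e a≡ n<s^e = ℕₚ.*-cancelˡ-≤ (suc n) (begin
  suc n * ∣ coeff s (suc a) b M ∣               ≤⟨ ℕₚ.*-mono-≤ n<s^e (∣coeff∣-crude t (suc a) b M) ⟩
  s ^ e * (s ^ b * ((suc a + b) C M))           ≡⟨ ℕₚ.*-assoc (s ^ e) _ _ ⟨
  s ^ e * s ^ b * ((suc a + b) C M)             ≡⟨ cong (_* ((suc a + b) C M)) (ℕₚ.^-distribˡ-+-* s e b) ⟨
  s ^ (e + b) * ((suc a + b) C M)               ≡⟨ cong₂ (λ k l → s ^ k * (suc l C M)) e+b≡sM a+b≡n ⟩
  s ^ (s * M) * (suc n C M)                     ≡⟨ ∣coeff₁∣-critical t m n n≡ ⟨
  suc n * ∣ coeff s 1 n M ∣                     ∎)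
  where
  open ℕₚ.≤-Reasoning
  s M : ℕ
  s = suc t
  M = suc m
  e+b≡sM : e + b ≡ s * M
  e+b≡sM = ℕₚ.+-cancelˡ-≡ M _ _ (trans (sym (ℕₚ.+-assoc M e b))
    (trans (cong (_+ b) (sym a≡)) (trans a+b≡n (sym n≡))))

-- The arguments are q - 1, i - 1, d - i and d - j.
data Exceptional : (s a b m : ℕ) → Set where
  exceptional : Exceptional 2 2 1 1

-- For s = 2 and index m + 1 ≤ 7, the ranges of first-half-bound and large-index-bound
-- leave a gap; the few coefficients in it are evaluated.
SmallCase : (m a b : ℕ) → Set
SmallCase m a b = let n = 3 * suc m in
  a ≤ b ⊎ suc n ≤ 2 ^ (a ∸ suc m) ⊎ (m ≡ 0 × a ≡ 2 × b ≡ 1) ⊎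
  ∣ coeff 2 (suc a) b (suc m) ∣ ≤ ∣ coeff 2 1 n (suc m) ∣

smallCase? : ∀ m a b → Dec (SmallCase m a b)
smallCase? m a b = let n = 3 * suc m in
  (a ℕₚ.≤? b) ⊎-dec (suc n ℕₚ.≤? 2 ^ (a ∸ suc m)) ⊎-dec
  ((m ℕₚ.≟ 0) ×-dec (a ℕₚ.≟ 2) ×-dec (b ℕₚ.≟ 1)) ⊎-dec
  (∣ coeff 2 (suc a) b (suc m) ∣ ℕₚ.≤? ∣ coeff 2 1 n (suc m) ∣)

-- Only b < a is left after `first-half-bound`; then 2 b < 3 (m + 1) ≤ 21, whence the limit 11.
small-cases : ∀ {m} → m < 7 → ∀ {b} → b < 11 → SmallCase m (3 * suc m ∸ b) b
small-cases = from-yes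
  (ℕₚ.allUpTo? (λ m → ℕₚ.allUpTo? (λ b → smallCase? m (3 * suc m ∸ b) b) 11) 7)

6e≤2^e+2 : ∀ k → 6 * (5 + k) ≤ 2 ^ (5 + k) + 2
6e≤2^e+2 zero    = from-yes (30 ℕₚ.≤? 34)
6e≤2^e+2 (suc k) = begin
  6 * (6 + k)             ≡⟨ ℕₚ.*-suc 6 (5 + k) ⟩
  6 + 6 * (5 + k)         ≤⟨ ℕₚ.+-mono-≤ (ℕₚ.≤-trans (from-yes (6 ℕₚ.≤? 32)) (ℕₚ.^-monoʳ-≤ 2 (ℕₚ.m≤m+n 5 k))) (6e≤2^e+2 k) ⟩
  p + (p + 2)             ≡⟨ double p ⟩
  2 * p + 2               ∎
  where
  open ℕₚ.≤-Reasoning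
  p : ℕ
  p = 2 ^ (5 + k)
  double : ∀ p → p + (p + 2) ≡ 2 * p + 2
  double = ℕ-Ring.solve-∀

4e≤3^e+1 : ∀ k → 4 * suc k ≤ 3 ^ suc k + 1
4e≤3^e+1 zero    = ℕₚ.≤-refl
4e≤3^e+1 (suc k) = begin
  4 * suc (suc k)         ≡⟨ ℕₚ.*-suc 4 (suc k) ⟩
  4 + 4 * suc k           ≤⟨ ℕₚ.+-mono-≤ (ℕₚ.≤-trans (from-yes (4 ℕₚ.≤? 6)) (ℕₚ.*-monoʳ-≤ 2 (ℕₚ.^-monoʳ-≤ 3 (s≤s (z≤n {k}))))) (4e≤3^e+1 k) ⟩
  2 * p + (p + 1)         ≡⟨ triple p ⟩
  3 * p + 1               ∎
  where
  open ℕₚ.≤-Reasoning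
  p : ℕ
  p = 3 ^ suc k
  triple : ∀ p → 2 * p + (p + 1) ≡ 3 * p + 1
  triple = ℕ-Ring.solve-∀

-- The hypothesis amounts to m < 2 e. Hence e ≥ 5, and 3 m + 3 ≤ 6 e ≤ 2^e + 2. At m = 7 the value e
-- = 4 is possible and 22 > 16, so the table has to reach index 7.
growth₂ : ∀ m e → 8 ≤ m → 2 * m < m + (e + e) → suc (3 * m) ≤ 2 ^ e
growth₂ m e 8≤m p = ℕₚ.+-cancelʳ-≤ 2 _ _ (begin
  suc (3 * m) + 2         ≡⟨ regroup m ⟩
  3 * suc m               ≤⟨ ℕₚ.*-monoʳ-≤ 3 m<2e ⟩
  3 * (e + e)             ≡⟨ sextuple e ⟩
  6 * e                   ≡⟨ cong (6 *_) e≡ ⟨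
  6 * (5 + (e ∸ 5))       ≤⟨ 6e≤2^e+2 (e ∸ 5) ⟩
  2 ^ (5 + (e ∸ 5)) + 2   ≡⟨ cong (λ x → 2 ^ x + 2) e≡ ⟩
  2 ^ e + 2               ∎)
  where
  open ℕₚ.≤-Reasoning
  regroup : ∀ m → suc (3 * m) + 2 ≡ 3 * suc m
  regroup = ℕ-Ring.solve-∀
  sextuple : ∀ e → 3 * (e + e) ≡ 6 * e
  sextuple = ℕ-Ring.solve-∀
  m<2e : m < e + e
  m<2e = ℕₚ.≤-trans (s≤s (ℕₚ.m≤m+n m 0)) (ℕₚ.+-cancelˡ-< m _ _ p)
  5≤e : 5 ≤ e
  5≤e = ℕₚ.≮⇒≥ λ { (s≤s e≤4) → ℕₚ.<-irrefl refl
    (ℕₚ.≤-trans (ℕₚ.≤-trans (s≤s 8≤m) m<2e) (ℕₚ.+-mono-≤ e≤4 e≤4)) }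
  e≡ : 5 + (e ∸ 5) ≡ e
  e≡ = ℕₚ.m+[n∸m]≡n 5≤e

-- The hypothesis amounts to (2 + u) m < 2 e, and 2 m ≤ (2 + u) m. So (4 + u) m + 2 ≤ 4 e ≤ 3^e + 1,
-- and s ≥ 3 needs no table.
growth₃ : ∀ u m e → (3 + u) * m < m + (e + e) → suc ((4 + u) * m) ≤ (3 + u) ^ e
growth₃ u m zero    p with () ← ℕₚ.+-cancelˡ-< m ((2 + u) * m) 0 p
growth₃ u m (suc e) p = ℕₚ.+-cancelʳ-≤ 1 _ _ (begin
  suc ((4 + u) * m) + 1             ≡⟨ regroup u m ⟩
  suc (2 * m) + suc ((2 + u) * m)   ≤⟨ ℕₚ.+-monoˡ-≤ _ (s≤s (ℕₚ.*-monoˡ-≤ m (ℕₚ.m≤m+n 2 u))) ⟩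
  suc ((2 + u) * m) + suc ((2 + u) * m) ≤⟨ ℕₚ.+-mono-≤ sm<2e sm<2e ⟩
  (suc e + suc e) + (suc e + suc e) ≡⟨ quadruple (suc e) ⟩
  4 * suc e                         ≤⟨ 4e≤3^e+1 e ⟩
  3 ^ suc e + 1                     ≤⟨ ℕₚ.+-monoˡ-≤ 1 (ℕₚ.^-monoˡ-≤ (suc e) (ℕₚ.m≤m+n 3 u)) ⟩
  (3 + u) ^ suc e + 1               ∎)
  where
  open ℕₚ.≤-Reasoning
  regroup : ∀ u m → suc ((4 + u) * m) + 1 ≡ suc (2 * m) + suc ((2 + u) * m)
  regroup = ℕ-Ring.solve-∀
  quadruple : ∀ e → (e + e) + (e + e) ≡ 4 * e
  quadruple = ℕ-Ring.solve-∀
  sm<2e : (2 + u) * m < suc e + suc e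
  sm<2e = ℕₚ.+-cancelˡ-< m _ _ p

critical-bound : ∀ u m a b → (3 + u) * suc m ≡ a + b →
  ∣ coeff (2 + u) (suc a) b (suc m) ∣ ≤ ∣ coeff (2 + u) 1 (a + b) (suc m) ∣ ⊎
  Exceptional (2 + u) a b (suc m)
critical-bound u m a b n≡ with a ℕₚ.≤? b
... | yes a≤b = inj₁ (first-half-bound (suc u) m (a + b) n≡ a b refl a≤b)
... | no  a≰b = second-half u n≡
  where
  M e : ℕ
  M = suc m
  e = a ∸ M
  b<a : b < a
  b<a = ℕₚ.≰⇒> a≰b
  -- Otherwise b < a < M, and a + b would be below 2 M.
  M≤a : ∀ u → (3 + u) * M ≡ a + b → M ≤ a
  M≤a u n≡ = ℕₚ.≮⇒≥ λ a<M → ℕₚ.<-irrefl (sym n≡) (ℕₚ.<-≤-trans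
    (ℕₚ.+-mono-< a<M (ℕₚ.<-trans b<a a<M)) (ℕₚ.+-monoʳ-≤ M (ℕₚ.m≤m+n M ((1 + u) * M))))
  a≡ : ∀ u → (3 + u) * M ≡ a + b → a ≡ M + e
  a≡ u n≡ = sym (ℕₚ.m+[n∸m]≡n (M≤a u n≡))
  sM<M+2e : ∀ u → (3 + u) * M ≡ a + b → (2 + u) * M < M + (e + e)
  sM<M+2e u n≡ = ℕₚ.+-cancelˡ-< M _ _ (begin-strict
    M + (2 + u) * M     ≡⟨ n≡ ⟩
    a + b               <⟨ ℕₚ.+-monoʳ-< a b<a ⟩
    a + a               ≡⟨ cong₂ _+_ (a≡ u n≡) (a≡ u n≡) ⟩
    (M + e) + (M + e)   ≡⟨ regroup M e ⟩
    M + (M + (e + e))   ∎)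
    where
    open ℕₚ.≤-Reasoning
    regroup : ∀ M e → (M + e) + (M + e) ≡ M + (M + (e + e))
    regroup = ℕ-Ring.solve-∀
  -- `u` is an argument again so that s ≥ 3 can be split from s = 2.
  second-half : ∀ u → (3 + u) * M ≡ a + b →
    ∣ coeff (2 + u) (suc a) b M ∣ ≤ ∣ coeff (2 + u) 1 (a + b) M ∣ ⊎ Exceptional (2 + u) a b M
  second-half (suc u) n≡ = inj₁ (large-index-bound (2 + u) m (a + b) n≡ a b refl e (a≡ (suc u) n≡)
    (subst (λ n → suc n ≤ (3 + u) ^ e) n≡ (growth₃ u M e (sM<M+2e (suc u) n≡))))
  second-half zero n≡ with m ℕₚ.<? 7
  ... | no  m≮7 = inj₁ (large-index-bound 1 m (a + b) n≡ a b refl e (a≡ 0 n≡)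
    (subst (λ n → suc n ≤ 2 ^ e) n≡ (growth₂ M e (s≤s (ℕₚ.≮⇒≥ m≮7)) (sM<M+2e 0 n≡))))
  ... | yes m<7 = from-table (subst (λ a → SmallCase m a b) n∸b≡a (small-cases m<7 b<11))
    where
    b<11 : b < 11
    b<11 = ℕₚ.≰⇒> λ 11≤b → ℕₚ.<-irrefl refl (begin-strict
      21           <⟨ ℕₚ.+-mono-≤ (ℕₚ.≤-trans 11≤b (ℕₚ.<⇒≤ b<a)) 11≤b ⟩
      a + b        ≡⟨ n≡ ⟨
      3 * M        ≤⟨ ℕₚ.*-monoʳ-≤ 3 m<7 ⟩
      21           ∎)
      where open ℕₚ.≤-Reasoning
    n∸b≡a : 3 * M ∸ b ≡ a
    n∸b≡a = trans (cong (_∸ b) n≡) (ℕₚ.m+n∸n≡m a b)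
    from-table : SmallCase m a b →
      ∣ coeff 2 (suc a) b M ∣ ≤ ∣ coeff 2 1 (a + b) M ∣ ⊎ Exceptional 2 a b M
    from-table (inj₁ a≤b) = ⊥-elim (a≰b a≤b)
    from-table (inj₂ (inj₁ n<2^e)) = inj₁ (large-index-bound 1 m (a + b) n≡ a b refl e (a≡ 0 n≡)
      (subst (λ n → suc n ≤ 2 ^ e) n≡ n<2^e))
    from-table (inj₂ (inj₂ (inj₁ (m≡0 , a≡2 , b≡1)))) rewrite m≡0 | a≡2 | b≡1 = inj₂ exceptional
    from-table (inj₂ (inj₂ (inj₂ p))) =
      inj₁ (subst (λ n → ∣ coeff 2 (suc a) b M ∣ ≤ ∣ coeff 2 1 n M ∣) n≡ p)

-- Induction from the critical case to all larger d.

-- With d = a + b + 1 the hypothesis is q m < d. Equality q m = a + b is the critical case;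
-- otherwise one factor 1 - z is removed and d drops by one. The triangle inequality then suffices
-- because s ≥ 1 in `∣coeff₁∣-suc`.
bound : ∀ u a b m → (3 + u) * m ≤ a + b →
  ∣ coeff (2 + u) (suc a) b m ∣ ≤ ∣ coeff (2 + u) 1 (a + b) m ∣ ⊎ Exceptional (2 + u) a b m
bound u zero b m _ = inj₁ ℕₚ.≤-refl
bound u (suc a) b m p with ℕₚ.m≤n⇒m<n∨m≡n p
bound u (suc a) b zero    _ | inj₂ 0≡ with () ← trans (sym (ℕₚ.*-zeroʳ (3 + u))) 0≡
bound u (suc a) b (suc m) _ | inj₂ n≡ = critical-bound u m (suc a) b n≡
bound u (suc a) b m       _ | inj₁ (s≤s p) = step (bound u a b m p) (shifted m p)
  where
  s n : ℕ
  s = 2 + u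
  n = a + b
  shifted : ∀ m → suc s * m ≤ n → ∣ shift (coeff s (suc a) b) m ∣ ≤ ∣ shift (coeff s 1 n) m ∣
  shifted zero    _ = z≤n
  shifted (suc m) p with bound u a b m (ℕₚ.≤-trans (ℕₚ.*-monoʳ-≤ (suc s) (ℕₚ.n≤1+n m)) p)
  ... | inj₁ q = q
  -- The exception at index 1 has a + b = 3, while index 2 would require 6 ≤ 3.
  ... | inj₂ exceptional with () ← ℕₚ.≤⇒≤ᵇ p
  step : ∣ coeff s (suc a) b m ∣ ≤ ∣ coeff s 1 n m ∣ ⊎ Exceptional s a b m →
    ∣ shift (coeff s (suc a) b) m ∣ ≤ ∣ shift (coeff s 1 n) m ∣ →
    ∣ coeff s (2 + a) b m ∣ ≤ ∣ coeff s 1 (suc n) m ∣ ⊎ Exceptional s (suc a) b m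
  step (inj₁ q) r = inj₁ (begin
    ∣ coeff s (suc a) b m ℤ.- shift (coeff s (suc a) b) m ∣
      ≤⟨ ℤₚ.∣i-j∣≤∣i∣+∣j∣ (coeff s (suc a) b m) (shift (coeff s (suc a) b) m) ⟩
    ∣ coeff s (suc a) b m ∣ + ∣ shift (coeff s (suc a) b) m ∣   ≤⟨ ℕₚ.+-mono-≤ q r ⟩
    ∣ coeff s 1 n m ∣ + ∣ shift (coeff s 1 n) m ∣
      ≤⟨ ℕₚ.+-monoˡ-≤ _ (ℕₚ.m≤n*m ∣ coeff s 1 n m ∣ s) ⟩
    s * ∣ coeff s 1 n m ∣ + ∣ shift (coeff s 1 n) m ∣
      ≡⟨ ∣coeff₁∣-suc (suc u) n m (ℕₚ.m≤n⇒m≤1+n p) ⟨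
    ∣ coeff s 1 (suc n) m ∣ ∎)
    where open ℕₚ.≤-Reasoning
  step (inj₂ x) _ = inj₁ (after-exception x)
    where
    after-exception : ∀ {s a b m} → Exceptional s a b m →
      ∣ coeff s (2 + a) b m ∣ ≤ ∣ coeff s 1 (suc (a + b)) m ∣
    -- The exception does not propagate: at d = 5 the coefficients are -7 and 16.
    after-exception exceptional = from-yes (7 ℕₚ.≤? 16)

-- Krawtchouk sums as reversed coefficients.

-- The Cauchy product, with recursion along `f` so that it unfolds in the order of the sum in `K`.
convolve : (f g : ℕ → ℤ) → ℕ → ℤ
convolve f g zero    = f 0 ℤ.* g 0
convolve f g (suc j) = f 0 ℤ.* g (suc j) ℤ.+ convolve (f ∘ suc) g j

sum≡convolve : ∀ (t f g : ℕ → ℤ) j → (∀ h → t h ≡ f h ℤ.* g (j ∸ h)) →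
  ∑[ h ≤ j ] t (toℕ h) ≡ convolve f g j
sum≡convolve t f g zero    t≡ = trans (ℤₚ.+-identityʳ (t 0)) (t≡ 0)
sum≡convolve t f g (suc j) t≡ =
  cong₂ ℤ._+_ (t≡ 0) (sum≡convolve (t ∘ suc) (f ∘ suc) g j (t≡ ∘ suc))

convolve-zeroˡ : ∀ {f} g → (∀ h → f h ≡ 0ℤ) → ∀ j → convolve f g j ≡ 0ℤ
convolve-zeroˡ g f≡0 zero    = cong (ℤ._* g 0) (f≡0 0)
convolve-zeroˡ g f≡0 (suc j) =
  cong₂ ℤ._+_ (cong (ℤ._* g (suc j)) (f≡0 0)) (convolve-zeroˡ g (f≡0 ∘ suc) j)

convolve-distribʳ-minus : ∀ {f f₁ f₂} g → (∀ h → f h ≡ f₁ h ℤ.- f₂ h) →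
  ∀ j → convolve f g j ≡ convolve f₁ g j ℤ.- convolve f₂ g j
convolve-distribʳ-minus {f} {f₁} {f₂} g f≡ zero =
  trans (cong (ℤ._* g 0) (f≡ 0)) (distrib (f₁ 0) (f₂ 0) (g 0))
  where
  distrib : ∀ x y z → (x ℤ.- y) ℤ.* z ≡ x ℤ.* z ℤ.- y ℤ.* z
  distrib = solve-∀
convolve-distribʳ-minus {f} {f₁} {f₂} g f≡ (suc j) =
  trans (cong₂ (λ x y → x ℤ.* g (suc j) ℤ.+ y) (f≡ 0) (convolve-distribʳ-minus g (f≡ ∘ suc) j))
    (distrib (f₁ 0) (f₂ 0) (g (suc j)) (convolve (f₁ ∘ suc) g j) (convolve (f₂ ∘ suc) g j))
  where
  distrib : ∀ x y z v w → (x ℤ.- y) ℤ.* z ℤ.+ (v ℤ.- w) ≡ (x ℤ.* z ℤ.+ v) ℤ.- (y ℤ.* z ℤ.+ w)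
  distrib = solve-∀

convolve-shiftˡ : ∀ f g j → convolve (shift f) g j ≡ shift (convolve f g) j
convolve-shiftˡ f g zero    = refl
convolve-shiftˡ f g (suc j) = ℤₚ.+-identityˡ (convolve f g j)

[1-z]^ : (a : ℕ) → ℕ → ℤ
[1-z]^ a h = -1ℤ ℤ.^ h ℤ.* + (a C h)

[1+sz]^ : (s b : ℕ) → ℕ → ℤ
[1+sz]^ s b k = + (s ^ k * (b C k))

pos-^ : ∀ s k → (+ s) ℤ.^ k ≡ + (s ^ k)
pos-^ s zero    = refl
pos-^ s (suc k) = trans (cong (+ s ℤ.*_) (pos-^ s k)) (sym (pos-* s (s ^ k)))

[1-z]^-suc : ∀ a h → [1-z]^ (suc a) h ≡ [1-z]^ a h ℤ.- shift ([1-z]^ a) h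
[1-z]^-suc a zero    = cong (λ x → (1ℤ ℤ.* + x) ℤ.- 0ℤ) (trans (nC0≡1 (suc a)) (sym (nC0≡1 a)))
[1-z]^-suc a (suc h) = trans
  (cong (λ x → -1ℤ ℤ.^ suc h ℤ.* + x) (sym (nCk+nC[k+1]≡[n+1]C[k+1] a h)))
  (distrib (-1ℤ ℤ.^ h) (+ (a C h)) (+ (a C suc h)))
  where
  distrib : ∀ (p x y : ℤ) → (-1ℤ ℤ.* p) ℤ.* (x ℤ.+ y) ≡ (-1ℤ ℤ.* p) ℤ.* y ℤ.- p ℤ.* x
  distrib = solve-∀

-- The coefficient of z^j in (1 - z)^a (1 + s z)^b, the classical generating function, with a = i
-- and b = d - i.
krawtchouk : (s a b : ℕ) → ℕ → ℤ
krawtchouk s a b = convolve ([1-z]^ a) ([1+sz]^ s b)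

krawtchouk-zero : ∀ s b j → krawtchouk s 0 b j ≡ [1+sz]^ s b j
krawtchouk-zero s b zero    = ℤₚ.*-identityˡ _
krawtchouk-zero s b (suc j) = trans
  (cong₂ ℤ._+_ (ℤₚ.*-identityˡ ([1+sz]^ s b (suc j)))
    (convolve-zeroˡ ([1+sz]^ s b) (λ h → ℤₚ.*-zeroʳ (-1ℤ ℤ.^ suc h)) j))
  (ℤₚ.+-identityʳ _)

krawtchouk-suc : ∀ s a b j → krawtchouk s (suc a) b j ≡ krawtchouk s a b j ℤ.- shift (krawtchouk s a b) j
krawtchouk-suc s a b j = trans (convolve-distribʳ-minus ([1+sz]^ s b) ([1-z]^-suc a) j)
  (cong (λ x → krawtchouk s a b j ℤ.- x) (convolve-shiftˡ ([1-z]^ a) ([1+sz]^ s b) j))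

k>n⇒krawtchouk≡0 : ∀ s a b {j} → a + b < j → krawtchouk s a b j ≡ 0ℤ
k>n⇒krawtchouk≡0 s zero b {j} b<j = trans (krawtchouk-zero s b j)
  (cong +_ (trans (cong (s ^ j *_) (k>n⇒nCk≡0 b<j)) (ℕₚ.*-zeroʳ (s ^ j))))
k>n⇒krawtchouk≡0 s (suc a) b {suc j} (s≤s p) = trans (krawtchouk-suc s a b (suc j))
  (cong₂ ℤ._-_ (k>n⇒krawtchouk≡0 s a b (ℕₚ.m<n⇒m<1+n p)) (k>n⇒krawtchouk≡0 s a b p))

-- z^d (1 - 1/z)^a (1 + s/z)^b = (-1)^a (1 - z)^a (s + z)^b  for  d = a + b.
krawtchouk-reverse : ∀ s a b j m → j + m ≡ a + b → krawtchouk s a b j ≡ -1ℤ ℤ.^ a ℤ.* coeff s a b m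
krawtchouk-reverse s zero b j m refl = begin
  krawtchouk s 0 b j                            ≡⟨ krawtchouk-zero s b j ⟩
  + (s ^ j * ((j + m) C j))               ≡⟨ cong (λ x → + (s ^ j * x)) (nCk≡nC[n∸k] (ℕₚ.m≤m+n j m)) ⟩
  + (s ^ j * ((j + m) C (j + m ∸ j)))
    ≡⟨ cong₂ (λ k l → + (s ^ k * ((j + m) C l))) (sym (ℕₚ.m+n∸n≡m j m)) (ℕₚ.m+n∸m≡n j m) ⟩
  + (s ^ (j + m ∸ m) * ((j + m) C m))     ≡⟨ coeff₀-formula s (j + m) m ⟨
  coeff s 0 (j + m) m                     ≡⟨ ℤₚ.*-identityˡ _ ⟨
  1ℤ ℤ.* coeff s 0 (j + m) m              ∎
  where open ≡-Reasoning
krawtchouk-reverse s (suc a) b j m j+m≡ = begin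
  krawtchouk s (suc a) b j                                    ≡⟨ krawtchouk-suc s a b j ⟩
  krawtchouk s a b j ℤ.- shift (krawtchouk s a b) j                 ≡⟨ cong₂ ℤ._-_ (unshifted j m j+m≡) (shifted j m j+m≡) ⟩
  p ℤ.* shift (coeff s a b) m ℤ.- p ℤ.* coeff s a b m   ≡⟨ factor p (shift (coeff s a b) m) (coeff s a b m) ⟩
  (-1ℤ ℤ.* p) ℤ.* (coeff s a b m ℤ.- shift (coeff s a b) m) ∎
  where
  open ≡-Reasoning
  p : ℤ
  p = -1ℤ ℤ.^ a
  factor : ∀ p x y → p ℤ.* x ℤ.- p ℤ.* y ≡ (-1ℤ ℤ.* p) ℤ.* (y ℤ.- x)
  factor = solve-∀
  -- With one factor fewer the degree is a + b, so `j` pairs with m - 1 and j - 1 with `m`. At m = 0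
  -- or j = 0 the partner lies beyond the degree and both sides vanish.
  unshifted : ∀ j m → j + m ≡ suc (a + b) → krawtchouk s a b j ≡ p ℤ.* shift (coeff s a b) m
  unshifted j zero    e = trans
    (k>n⇒krawtchouk≡0 s a b (ℕₚ.≤-reflexive (trans (sym e) (ℕₚ.+-identityʳ j)))) (sym (ℤₚ.*-zeroʳ p))
  unshifted j (suc m) e = krawtchouk-reverse s a b j m (ℕₚ.suc-injective (trans (sym (ℕₚ.+-suc j m)) e))
  shifted : ∀ j m → j + m ≡ suc (a + b) → shift (krawtchouk s a b) j ≡ p ℤ.* coeff s a b m
  shifted zero    m e = sym (trans
    (cong (p ℤ.*_) (k>n⇒coeff≡0 s a b (ℕₚ.≤-reflexive (sym e)))) (ℤₚ.*-zeroʳ p))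
  shifted (suc j) m e = krawtchouk-reverse s a b j m (ℕₚ.suc-injective e)

K≡krawtchouk : ∀ s d j i → K (suc s) d j i ≡ krawtchouk s i (d ∸ i) j
K≡krawtchouk s d j i = sum≡convolve (krawtchoukTerm (suc s) d j i) _ _ j λ h → begin
  -1ℤ ℤ.^ h ℤ.* (+ s) ℤ.^ (j ∸ h) ℤ.* + (i C h) ℤ.* + ((d ∸ i) C (j ∸ h))
    ≡⟨ interchange (-1ℤ ℤ.^ h) ((+ s) ℤ.^ (j ∸ h)) (+ (i C h)) (+ ((d ∸ i) C (j ∸ h))) ⟩
  [1-z]^ i h ℤ.* ((+ s) ℤ.^ (j ∸ h) ℤ.* + ((d ∸ i) C (j ∸ h)))
    ≡⟨ cong (λ x → [1-z]^ i h ℤ.* (x ℤ.* + ((d ∸ i) C (j ∸ h)))) (pos-^ s (j ∸ h)) ⟩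
  [1-z]^ i h ℤ.* (+ (s ^ (j ∸ h)) ℤ.* + ((d ∸ i) C (j ∸ h)))
    ≡⟨ cong ([1-z]^ i h ℤ.*_) (pos-* (s ^ (j ∸ h)) ((d ∸ i) C (j ∸ h))) ⟨
  [1-z]^ i h ℤ.* [1+sz]^ s (d ∸ i) (j ∸ h) ∎
  where
  open ≡-Reasoning
  interchange : ∀ w x y z → w ℤ.* x ℤ.* y ℤ.* z ≡ (w ℤ.* y) ℤ.* (x ℤ.* z)
  interchange = solve-∀

K≡±coeff : ∀ s d j i m → j + m ≡ d → i ≤ d →
  K (suc s) d j i ≡ -1ℤ ℤ.^ i ℤ.* coeff s i (d ∸ i) m
K≡±coeff s d j i m j+m≡d i≤d = trans (K≡krawtchouk s d j i)
  (krawtchouk-reverse s i (d ∸ i) j m (trans j+m≡d (sym (ℕₚ.m+[n∸m]≡n i≤d))))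

∣-1^a*i∣≡∣i∣ : ∀ a i → ∣ -1ℤ ℤ.^ a ℤ.* i ∣ ≡ ∣ i ∣
∣-1^a*i∣≡∣i∣ zero    i = cong ∣_∣ (ℤₚ.*-identityˡ i)
∣-1^a*i∣≡∣i∣ (suc a) i = begin
  ∣ -1ℤ ℤ.* -1ℤ ℤ.^ a ℤ.* i ∣     ≡⟨ cong ∣_∣ (ℤₚ.*-assoc -1ℤ (-1ℤ ℤ.^ a) i) ⟩
  ∣ -1ℤ ℤ.* (-1ℤ ℤ.^ a ℤ.* i) ∣   ≡⟨ cong ∣_∣ (ℤₚ.-1*i≡-i (-1ℤ ℤ.^ a ℤ.* i)) ⟩
  ∣ ℤ.- (-1ℤ ℤ.^ a ℤ.* i) ∣       ≡⟨ ℤₚ.∣-i∣≡∣i∣ (-1ℤ ℤ.^ a ℤ.* i) ⟩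
  ∣ -1ℤ ℤ.^ a ℤ.* i ∣             ≡⟨ ∣-1^a*i∣≡∣i∣ a i ⟩
  ∣ i ∣                           ∎
  where open ≡-Reasoning

∣K∣≡∣coeff∣ : ∀ s d j i m → j + m ≡ d → i ≤ d → ∣ K (suc s) d j i ∣ ≡ ∣ coeff s i (d ∸ i) m ∣
∣K∣≡∣coeff∣ s d j i m j+m≡d i≤d = trans (cong ∣_∣ (K≡±coeff s d j i m j+m≡d i≤d))
  (∣-1^a*i∣≡∣i∣ i (coeff s i (d ∸ i) m))

-- From the rational hypothesis to the two claims.

-∣i∣≤i : ∀ i → ℤ.- + ∣ i ∣ ℤ.≤ i
-∣i∣≤i (+ n)       = ℤₚ.neg-≤-pos
-∣i∣≤i ℤ.-[1+ n ]  = ℤₚ.≤-refl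

clear-denominator : ∀ q′ j m n → j + m ≡ suc n →
  (+ suc n / 1) ℚᵘ.- ((+ suc n ℤ.- 1ℤ) / suc q′) ℚᵘ.≤ (+ j / 1) → suc q′ * m ≤ n
clear-denominator q′ j m n j+m≡d (ℚᵘ.*≤* p) = ℕₚ.+-cancelˡ-≤ (j * q) _ _ (let open ℕₚ.≤-Reasoning in begin
  j * q + q * m         ≡⟨ cong (λ x → j * q + x) (ℕₚ.*-comm q m) ⟩
  j * q + m * q         ≡⟨ ℕₚ.*-distribʳ-+ q j m ⟨
  (j + m) * q           ≡⟨ cong (_* q) j+m≡d ⟩
  suc n * q             ≤⟨ ℤₚ.drop‿+≤+ dq≤jq+n ⟩
  j * q + n             ∎)
  where
  q : ℕ
  q = suc q′
  -- The shape comes from cross-multiplication: d/1 - n/q has numerator d q + (-n) 1, which is then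
  -- multiplied by the denominator 1 of j/1.
  add-back : ∀ x n → (x ℤ.+ (ℤ.- n) ℤ.* 1ℤ) ℤ.* 1ℤ ℤ.+ n ≡ x
  add-back = solve-∀
  dq≤jq+n : + (suc n * q) ℤ.≤ + (j * q + n)
  dq≤jq+n = let open ℤₚ.≤-Reasoning in begin
    + (suc n * q)                                                 ≡⟨ pos-* (suc n) q ⟩
    + suc n ℤ.* + q                                               ≡⟨ add-back _ (+ n) ⟨
    (+ suc n ℤ.* + q ℤ.+ (ℤ.- + n) ℤ.* 1ℤ) ℤ.* 1ℤ ℤ.+ + n         ≤⟨ ℤₚ.+-monoˡ-≤ (+ n) p ⟩
    + j ℤ.* + (1 * q) ℤ.+ + n                                     ≡⟨ cong (ℤ._+ + n) (pos-* j (1 * q)) ⟨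
    + (j * (1 * q)) ℤ.+ + n                                       ≡⟨ cong (λ x → + (j * x + n)) (ℕₚ.*-identityˡ q) ⟩
    + (j * q + n)                                                 ∎

Excluded : (q d i j : ℕ) → Set
Excluded q d i j = _≡_ {A = ℕ × ℕ × ℕ × ℕ} (q , d , i , j) (3 , 4 , 3 , 3)

module _ (u n j m : ℕ) (j+m≡d : j + m ≡ suc n) (qm<d : (3 + u) * m ≤ n) where

  private
    q d : ℕ
    q = 3 + u
    d = suc n

  -- The sign (-1)^1 meets a non-negative coefficient. Thus for i ≥ 1 the lower bound (i) follows
  -- wherever the absolute bound (ii) holds.
  K₁≡-∣K₁∣ : K q d j 1 ≡ ℤ.- + ∣ K q d j 1 ∣
  K₁≡-∣K₁∣ = begin
    K q d j 1                           ≡⟨ K≡±coeff (2 + u) d j 1 m j+m≡d (s≤s z≤n) ⟩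
    -1ℤ ℤ.* coeff (2 + u) 1 n m         ≡⟨ ℤₚ.-1*i≡-i (coeff (2 + u) 1 n m) ⟩
    ℤ.- coeff (2 + u) 1 n m
      ≡⟨ cong ℤ.-_ (ℤₚ.0≤i⇒+∣i∣≡i (coeff₁-nonNeg (suc u) n m (ℕₚ.m≤n⇒m≤1+n qm<d))) ⟨
    ℤ.- + ∣ coeff (2 + u) 1 n m ∣
      ≡⟨ cong (λ x → ℤ.- + x) (∣K∣≡∣coeff∣ (2 + u) d j 1 m j+m≡d (s≤s z≤n)) ⟨
    ℤ.- + ∣ K q d j 1 ∣                 ∎
    where open ≡-Reasoning

  ∣K∣≤∣K₁∣ : ∀ i → 1 ≤ i → i ≤ d →
    ∣ K q d j i ∣ ≤ ∣ K q d j 1 ∣ ⊎ Excluded q d i j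
  ∣K∣≤∣K₁∣ (suc a) _ (s≤s a≤n) = from-bound
    (bound u a (n ∸ a) m (ℕₚ.≤-trans qm<d (ℕₚ.≤-reflexive (sym a+b≡n))))
    where
    a+b≡n : a + (n ∸ a) ≡ n
    a+b≡n = ℕₚ.m+[n∸m]≡n a≤n
    parameters : ∀ {s b} → Exceptional s a b m → a + b ≡ n → Excluded (suc s) d (suc a) j
    parameters exceptional refl = cong (λ j → 3 , 4 , 3 , j) (ℕₚ.+-cancelʳ-≡ 1 j 3 j+m≡d)
    from-bound : ∣ coeff (2 + u) (suc a) (n ∸ a) m ∣ ≤ ∣ coeff (2 + u) 1 (a + (n ∸ a)) m ∣ ⊎
        Exceptional (2 + u) a (n ∸ a) m →
      ∣ K q d j (suc a) ∣ ≤ ∣ K q d j 1 ∣ ⊎ Excluded q d (suc a) j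
    from-bound (inj₁ p) = inj₁ (begin
      ∣ K q d j (suc a) ∣                         ≡⟨ ∣K∣≡∣coeff∣ (2 + u) d j (suc a) m j+m≡d (s≤s a≤n) ⟩
      ∣ coeff (2 + u) (suc a) (n ∸ a) m ∣         ≤⟨ p ⟩
      ∣ coeff (2 + u) 1 (a + (n ∸ a)) m ∣         ≡⟨ cong (λ n → ∣ coeff (2 + u) 1 n m ∣) a+b≡n ⟩
      ∣ coeff (2 + u) 1 n m ∣                     ≡⟨ ∣K∣≡∣coeff∣ (2 + u) d j 1 m j+m≡d (s≤s z≤n) ⟨
      ∣ K q d j 1 ∣                               ∎)
      where open ℕₚ.≤-Reasoning
    from-bound (inj₂ x) = inj₂ (parameters x a+b≡n)

  K₁≤K : ∀ i → i ≤ d → K q d j 1 ℤ.≤ K q d j i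
  -- The absolute bound starts at i = 1; for i = 0 the signs alone decide.
  K₁≤K zero    i≤d = begin
    K q d j 1                     ≡⟨ K₁≡-∣K₁∣ ⟩
    ℤ.- + ∣ K q d j 1 ∣           ≤⟨ ℤₚ.neg-≤-pos {∣ K q d j 1 ∣} {0} ⟩
    0ℤ                            ≤⟨ coeff₀-nonNeg (2 + u) d m ⟩
    coeff (2 + u) 0 d m           ≡⟨ ℤₚ.*-identityˡ _ ⟨
    1ℤ ℤ.* coeff (2 + u) 0 d m    ≡⟨ K≡±coeff (2 + u) d j 0 m j+m≡d i≤d ⟨
    K q d j 0                     ∎
    where open ℤₚ.≤-Reasoning
  K₁≤K (suc a) i≤d with ∣K∣≤∣K₁∣ (suc a) (s≤s z≤n) i≤d
  -- The excluded case violates (ii) but not (i): the values are -4 and 5.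
  ... | inj₂ refl = ℤ.-≤+
  ... | inj₁ p    = begin
    K q d j 1                     ≡⟨ K₁≡-∣K₁∣ ⟩
    ℤ.- + ∣ K q d j 1 ∣           ≤⟨ ℤₚ.neg-mono-≤ (ℤ.+≤+ p) ⟩
    ℤ.- + ∣ K q d j (suc a) ∣     ≤⟨ -∣i∣≤i (K q d j (suc a)) ⟩
    K q d j (suc a)               ∎
    where open ℤₚ.≤-Reasoning

theorem1p4 : (q d j : ℕ) .{{_ : NonZero q}} →
    3 ≤ q → 1 ≤ d →
    (+ d / 1) ℚᵘ.- ((+ d ℤ.- 1ℤ) / q) ℚᵘ.≤ (+ j / 1) →
    j ≤ d →
    ((i : ℕ) → i ≤ d → K q d j 1 ℤ.≤ K q d j i)
    ×
    ((i : ℕ) → 1 ≤ i → i ≤ d → (q , d , i , j) ≢ (3 , 4 , 3 , 3) →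
      ∣ K q d j i ∣ ≤ ∣ K q d j 1 ∣)
theorem1p4 (suc (suc (suc u))) (suc n) j (s≤s (s≤s (s≤s _))) _ j≥ j≤d =
  K₁≤K u n j m j+m≡d qm<d ,
  λ i 1≤i i≤d i≢ → [ id , ⊥-elim ∘ i≢ ]′ (∣K∣≤∣K₁∣ u n j m j+m≡d qm<d i 1≤i i≤d)
  where
  m : ℕ
  m = suc n ∸ j
  j+m≡d : j + m ≡ suc n
  j+m≡d = ℕₚ.m+[n∸m]≡n j≤d
  qm<d : (3 + u) * m ≤ n
  qm<d = clear-denominator (2 + u) j m n j+m≡d j≥
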